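{- Let $\mathcal{I}$ be a CSP instance and let $c,d,k\in\mathbb{N}_0$. (1) $\mathcal{I}$ has threshold-$d$ load-$c$ treewidth at most $k$ if and only if $G^d_{\mathcal{I}}$ admits an elimination ordering $v_1,\dots,v_n$ of width at most $k$ with the property that for each $v_i$, the set $N_{G^d_{\mathcal{I},i-1}}(v_i)\cup\{v_i\}$ contains at most $c$ heavy vertices. (2) $\mathcal{I}$ has generalized threshold-$d$ load-$c$ hypertree width at most $k$ if and only if $G_{\mathcal{I}}$ admits an elimination ordering $v_1,\dots,v_n$ of cover width at most $k$ with the property that for each $v_i$, the set $N_{G^d_{\mathcal{I},i-1}}(v_i)\cup\{v_i\}$ admits a hyperedge cover in $H^d_{\mathcal{I}}$ of size at most $k$ containing at most $c$ heavy hyperedges.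
   Context: $\mathbb{N}=\{1,2,\dots\}$, $\mathbb{N}_0=\mathbb{N}\cup\{0\}$. CSP. An instance $\mathcal{I}=(V,D,C)$ consists of a finite set $V$ of variables, a function $D$ mapping each $v\in V$ to its domain $D(v)$ (a finite set of natural numbers), and a set $C$ of constraints; a constraint $q$ has a scope $S(q)$, a completely ordered subset of $V$, and a $|S(q)|$-ary relation $R(q)$ on $\mathbb{N}$; for each scope there is at most one constraint with that scope. The primal graph $G_{\mathcal{I}}$ has vertex set $V$, with two distinct variables adjacent iff some scope contains both. The hypergraph $H_{\mathcal{I}}$ has vertex set $V$ and a hyperedge $E\subseteq V$ iff there is a constraint with scope $E$; it is assumed that every vertex lies in at least one hyperedge. $G^d_{\mathcal{I}}$ is $G_{\mathcal{I}}$ with each vertex $v$ marked light if $|D(v)|\le d$ and heavy otherwise. $H^d_{\mathcal{I}}$ is $H_{\mathcal{I}}$ with the hyperedge of a constraint $q$ marked light if $|R(q)|\le d$ and heavy otherwise. Decompositions. A tree decomposition of a (hyper)graph $G$ is a pair $(T,\chi)$ where $T$ is a tree and $\chi$ assigns to each node $t$ a bag $\chi(t)\subseteq V(G)$ such that every (hyper)edge is contained in some bag, and for every vertex $v$ the nodes $t$ with $v\in\chi(t)$ induce a non-empty subtree of $T$. Its width is the size of a largest bag minus 1. An edge cover of a vertex set $S$ in a hypergraph $H$ is a set $F\subseteq E(H)$ such that every $v\in S$ lies in some $e\in F$; its size is $|F|$. A generalized hypertree decomposition of $H$ is a triple $(T,\chi,\lambda)$ where $(T,\chi)$ is a tree decomposition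 of $H$ and $\lambda$ maps each node $t$ to an edge cover $\lambda(t)\subseteq E(H)$ of $\chi(t)$; its width is $\max_t|\lambda(t)|$. Threshold widths. The threshold-$d$ load-$c$ treewidth of $\mathcal{I}$ is the minimum width of a tree decomposition of $G^d_{\mathcal{I}}$ in which every bag contains at most $c$ heavy vertices ($\infty$ if none exists). The generalized threshold-$d$ load-$c$ hypertree width of $\mathcal{I}$ is the minimum width of a generalized hypertree decomposition of $H^d_{\mathcal{I}}$ in which every $\lambda(t)$ contains at most $c$ heavy hyperedges ($\infty$ if none exists). Elimination orderings. An elimination ordering of a graph $G$ is a total ordering $v_1,\dots,v_n$ of $V(G)$. Put $G_0=G$, and for $i=1,\dots,n$ let $G_i$ be obtained from $G_{i-1}$ by removing $v_i$ and adding edges between each pair of vertices in the neighborhood $N_{G_{i-1}}(v_i)$. For $G=G^d_{\mathcal{I}}$ these graphs are written $G^d_{\mathcal{I},i}$ (as unlabeled graphs they coincide with those obtained from $G_{\mathcal{I}}$). The width of $v_i$ is $|N_{G_{i-1}}(v_i)|$, and the width of the ordering is the maximum width over all vertices. For $G=G_{\mathcal{I}}$, the cover width of $v_i$ is the size of a minimum edge cover of $N_{G_{i-1}}(v_i)\cup\{v_i\}$ in $H_{\mathcal{I}}$, and the cover width of the ordering is the maximum cover width over all vertices. -}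

module Defs where

open import Data.Fin using (Fin; toℕ)
import Data.Fin.Properties as Fin
open import Data.Fin.Subset
  using (Subset; inside; outside; ⊤; ⁅_⁆; _∈_; _⊆_; _∩_; _∪_; ⋃; _-_; ∣_∣; Nonempty)
open import Data.Fin.Subset.Properties using (_∈?_; ∈⊤; x∈p∩q⁺; x∈p∧x≢y⇒x∈p-y)
open import Data.Integer as ℤ using (ℤ; +_; 1ℤ)
open import Data.List as List
  using (List; []; _∷_; [_]; _++_; _∷ʳ_; map; filter; length; lookup; take; foldl)
open import Data.List.Extrema.Nat using (min; max)
open import Data.List.Membership.Propositional using () renaming (_∈_ to _∈ˡ_)
open import Data.List.Relation.Unary.Linked using (Linked)
open import Data.List.Relation.Unary.Unique.Propositional using (Unique)
open import Data.Nat using (ℕ; zero; suc; _≤_)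
open import Data.Product using (Σ; ∃; ∃₂; _×_; _,_)
open import Data.Sum using (_⊎_; inj₁; inj₂)
open import Data.Vec as Vec using (Vec)
open import Function.Base using (_∘_)
open import Function.Bundles using (_⇔_)
open import Function.Definitions using (Injective)
open import Level using (0ℓ; _⊔_)
open import Relation.Binary using (Rel; Symmetric; Irreflexive)
import Relation.Binary as B
open import Relation.Binary.Construct.Closure.ReflexiveTransitive using (Star)
open import Relation.Binary.PropositionalEquality using (_≡_; _≢_; sym)
open import Relation.Nullary using (¬_; Dec; does; ¬?; _×-dec_; _⊎-dec_; _→-dec_)
open import Relation.Unary using (Pred; Decidable; ∁)

-- The cardinality of the extension of P is at most d. This applies to
-- arbitrary, possibly infinite, P.
AtMost : ∀ {a ℓ} {A : Set a} → ℕ → Pred A ℓ → Set (a ⊔ ℓ)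
AtMost {A = A} d P = ∃ λ (xs : List A) → length xs ≤ d × (∀ {x} → P x → x ∈ˡ xs)

⟦_⟧ : ∀ {n ℓ} {P : Pred (Fin n) ℓ} → Decidable P → Subset n
⟦ P? ⟧ = Vec.tabulate (does ∘ P?)

maximum : ∀ {m} → (Fin m → ℕ) → ℕ
maximum f = max 0 (List.tabulate f)

subsets : ∀ m → List (Subset m)
subsets zero    = [ Vec.[] ]
subsets (suc m) = map (outside Vec.∷_) (subsets m) ++ map (inside Vec.∷_) (subsets m)

------------------------------------------------------------------------
-- Graphs and trees

-- Finite simple graphs with vertex set V. Vertex sets are subsets of a
-- fixed Fin n so that vertices keep their names when others are removed.
record Graph {n} (V : Subset n) : Set₁ where
  infix 4 _~_ _~?_
  field
    _~_     : Rel (Fin n) 0ℓ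
    _~?_    : B.Decidable _~_
    ~-sym   : Symmetric _~_
    ~-irr   : Irreflexive _≡_ _~_
    ~-left  : ∀ {x y} → x ~ y → x ∈ V

  N : Fin n → Subset n
  N v = ⟦ v ~?_ ⟧

  N[_] : Fin n → Subset n
  N[ v ] = N v ∪ ⁅ v ⁆

  IsEdge : Pred (Subset n) 0ℓ
  IsEdge e = ∃₂ λ x y → x ~ y × e ≡ ⁅ x ⁆ ∪ ⁅ y ⁆

module _ {n} {V : Subset n} (G : Graph V) where
  open Graph G

  induced : (X : Subset n) → Graph (V ∩ X)
  induced X = record
    { _~_    = λ x y → x ~ y × x ∈ X × y ∈ X
    ; _~?_   = λ x y → (x ~? y) ×-dec (x ∈? X) ×-dec (y ∈? X)
    ; ~-sym  = λ (e , p , q) → ~-sym e , q , p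
    ; ~-irr  = λ x≡y (e , _) → ~-irr x≡y e
    ; ~-left = λ (e , p , _) → x∈p∩q⁺ (~-left e , p)
    }

  -- Remove v and make its neighbourhood a clique.
  eliminate : (v : Fin n) → Graph (V - v)
  eliminate v = record
    { _~_    = λ x y → x ≢ v × y ≢ v × (x ~ y ⊎ (x ≢ y × v ~ x × v ~ y))
    ; _~?_   = λ x y → ¬? (x Fin.≟ v) ×-dec ¬? (y Fin.≟ v) ×-dec
                 ((x ~? y) ⊎-dec (¬? (x Fin.≟ y) ×-dec (v ~? x) ×-dec (v ~? y)))
    ; ~-sym  = λ { (p , q , inj₁ e)            → q , p , inj₁ (~-sym e)
                 ; (p , q , inj₂ (x≢y , e , f)) → q , p , inj₂ (x≢y ∘ sym , f , e) }
    ; ~-irr  = λ { x≡y (_ , _ , inj₁ e)         → ~-irr x≡y e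
                 ; x≡y (_ , _ , inj₂ (x≢y , _)) → x≢y x≡y }
    ; ~-left = λ { (p , _ , inj₁ e)           → x∈p∧x≢y⇒x∈p-y (~-left e) p
                 ; (p , _ , inj₂ (_ , e , _)) → x∈p∧x≢y⇒x∈p-y (~-left (~-sym e)) p }
    }

  -- x ∷ xs lists the at least three distinct vertices of a cycle in order.
  IsCycle : Fin n → List (Fin n) → Set
  IsCycle x xs = 2 ≤ length xs × Unique (x ∷ xs) × Linked _~_ (x ∷ (xs ∷ʳ x))

  record IsTree : Set where
    field
      nonempty  : Nonempty V
      connected : ∀ {x y} → x ∈ V → y ∈ V → Star _~_ x y
      acyclic   : ∀ x xs → ¬ IsCycle x xs

------------------------------------------------------------------------
-- Hypergraphs

-- The indexing of hyperedges is injective, so that sets of hyperedges are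
-- the same as sets of indices.
record Hypergraph (n : ℕ) : Set where
  field
    edgeCount : ℕ
    edge      : Fin edgeCount → Subset n
    edge-inj  : Injective _≡_ _≡_ edge
    covered   : ∀ v → ∃ λ e → v ∈ edge e

  IsHyperedge : Pred (Subset n) 0ℓ
  IsHyperedge E = ∃ λ e → E ≡ edge e

  IsEdgeCover : Subset n → Subset edgeCount → Set
  IsEdgeCover S F = ∀ v → v ∈ S → ∃ λ e → e ∈ F × v ∈ edge e

  isEdgeCover? : ∀ S F → Dec (IsEdgeCover S F)
  isEdgeCover? S F = Fin.all? λ v → (v ∈? S) →-dec
    Fin.any? λ e → (e ∈? F) ×-dec (v ∈? edge e)

  -- The size of a minimum edge cover. The base value of min is that of the
  -- cover consisting of all hyperedges, so it does not affect the result.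
  coverNumber : Subset n → ℕ
  coverNumber S = min ∣ ⊤ {edgeCount} ∣ (map ∣_∣ (filter (isEdgeCover? S) (subsets edgeCount)))

------------------------------------------------------------------------
-- Marked graphs and hypergraphs

record MarkedGraph {n} (V : Subset n) : Set₁ where
  field
    graph : Graph V
    Light : Pred (Fin n) 0ℓ
  open Graph graph public

  Heavy : Pred (Fin n) 0ℓ
  Heavy = ∁ Light

  HeavyIn : Subset n → Pred (Fin n) 0ℓ
  HeavyIn S v = v ∈ S × Heavy v

record MarkedHypergraph (n : ℕ) : Set₁ where
  field
    hypergraph : Hypergraph n
  open Hypergraph hypergraph public
  field
    Light : Pred (Fin edgeCount) 0ℓ

  Heavy : Pred (Fin edgeCount) 0ℓ
  Heavy = ∁ Light

  HeavyIn : Subset edgeCount → Pred (Fin edgeCount) 0ℓ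
  HeavyIn F e = e ∈ F × Heavy e

------------------------------------------------------------------------
-- Decompositions

-- Tree decompositions of a (hyper)graph with vertex set V whose
-- (hyper)edges are the sets satisfying E.
record TreeDecomposition {n} (V : Subset n) (E : Pred (Subset n) 0ℓ) : Set₁ where
  field
    nodeCount : ℕ
    T         : Graph {nodeCount} ⊤
    T-tree    : IsTree T
    χ         : Fin nodeCount → Subset n
    χ⊆V       : ∀ t → χ t ⊆ V
    edge-in   : ∀ {e} → E e → ∃ λ t → e ⊆ χ t
    subtree   : ∀ {v} → v ∈ V → IsTree (induced T ⟦ (λ t → v ∈? χ t) ⟧)

  -- An integer because it is -1 if V is empty.
  width : ℤ
  width = + maximum (λ t → ∣ χ t ∣) ℤ.- 1ℤ

record GeneralizedHypertreeDecomposition {n} (H : Hypergraph n) : Set₁ where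
  open Hypergraph H
  field
    treeDecomposition : TreeDecomposition ⊤ IsHyperedge
  open TreeDecomposition treeDecomposition public hiding (width)
  field
    cover   : Fin nodeCount → Subset edgeCount
    isCover : ∀ t → IsEdgeCover (χ t) (cover t)

  width : ℕ
  width = maximum (λ t → ∣ cover t ∣)

------------------------------------------------------------------------
-- Elimination orderings

record EliminationOrdering {n} (V : Subset n) : Set where
  field
    order      : List (Fin n)
    unique     : Unique order
    enumerates : ∀ {v} → v ∈ˡ order ⇔ v ∈ V

  -- Positions count from 0: the vertex v_i of the sequence v_1, …, v_n is
  -- vertex at position i - 1.
  Position : Set
  Position = Fin (length order)

  vertex : Position → Fin n
  vertex = lookup order

eliminateAll : ∀ {n} {V : Subset n} → Graph V → (vs : List (Fin n)) → Graph (foldl _-_ V vs)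
eliminateAll G []       = G
eliminateAll G (v ∷ vs) = eliminateAll (eliminate G v) vs

module _ {n} {V : Subset n} (G : Graph V) (σ : EliminationOrdering V) where
  open EliminationOrdering σ

  stage : (i : ℕ) → Graph (foldl _-_ V (take i order))
  stage i = eliminateAll G (take i order)

  -- N_{G_{i-1}}(v_i) and N_{G_{i-1}}(v_i) ∪ {v_i} for v_i at position i - 1
  elimN elimN[_] : Position → Subset n
  elimN    p   = Graph.N    (stage (toℕ p)) (vertex p)
  elimN[_] p   = Graph.N[_] (stage (toℕ p)) (vertex p)

  orderingWidth : ℕ
  orderingWidth = maximum (λ p → ∣ elimN p ∣)

  coverWidth : Hypergraph n → ℕ
  coverWidth H = maximum (λ p → Hypergraph.coverNumber H (elimN[_] p))

------------------------------------------------------------------------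
-- CSP instances

-- The scope is ordered by its position in the list.
record Constraint (n : ℕ) : Set₁ where
  field
    scope        : List (Fin n)
    scope-unique : Unique scope
    relation     : Pred (Vec ℕ (length scope)) 0ℓ

  scopeSet : Subset n
  scopeSet = ⋃ (map ⁅_⁆ scope)

-- Instances with variable set Fin n.
record Instance (n : ℕ) : Set₁ where
  field
    domain          : Fin n → List ℕ
    domain-unique   : ∀ v → Unique (domain v)
    constraintCount : ℕ
    constraint      : Fin constraintCount → Constraint n

  scopeSet : Fin constraintCount → Subset n
  scopeSet q = Constraint.scopeSet (constraint q)

  field
    scope-inj : Injective _≡_ _≡_ scopeSet
    covered   : ∀ v → ∃ λ q → v ∈ scopeSet q

module _ {n} (I : Instance n) where
  open Instance I

  primalGraph : Graph {n} ⊤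
  primalGraph = record
    { _~_    = λ x y → x ≢ y × ∃ λ q → x ∈ scopeSet q × y ∈ scopeSet q
    ; _~?_   = λ x y → ¬? (x Fin.≟ y) ×-dec
                 Fin.any? λ q → (x ∈? scopeSet q) ×-dec (y ∈? scopeSet q)
    ; ~-sym  = λ (x≢y , q , x∈q , y∈q) → x≢y ∘ sym , q , y∈q , x∈q
    ; ~-irr  = λ x≡y (x≢y , _) → x≢y x≡y
    ; ~-left = λ _ → ∈⊤
    }

  constraintHypergraph : Hypergraph n
  constraintHypergraph = record
    { edgeCount = constraintCount
    ; edge      = scopeSet
    ; edge-inj  = scope-inj
    ; covered   = covered
    }

  thresholdGraph : ℕ → MarkedGraph {n} ⊤
  thresholdGraph d = record
    { graph = primalGraph
    ; Light = λ v → length (domain v) ≤ d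
    }

  thresholdHypergraph : ℕ → MarkedHypergraph n
  thresholdHypergraph d = record
    { hypergraph = constraintHypergraph
    ; Light      = λ q → AtMost d (Constraint.relation (constraint q))
    }

  -- A minimum of widths, ∞ when there are none, is at most k iff one of the
  -- widths is.
  ThresholdTreewidth≤ : (d c k : ℕ) → Set₁
  ThresholdTreewidth≤ d c k =
    Σ (TreeDecomposition ⊤ IsEdge) λ D → let open TreeDecomposition D in
      (∀ t → AtMost c (HeavyIn (χ t))) × width ℤ.≤ + k
    where open MarkedGraph (thresholdGraph d)

  GeneralizedThresholdHypertreeWidth≤ : (d c k : ℕ) → Set₁
  GeneralizedThresholdHypertreeWidth≤ d c k =
    Σ (GeneralizedHypertreeDecomposition hypergraph) λ D →
      let open GeneralizedHypertreeDecomposition D in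
      (∀ t → AtMost c (HeavyIn (cover t))) × width ≤ k
    where open MarkedHypergraph (thresholdHypergraph d)

{-# OPTIONS --safe #-}

-- A decomposition tree has a leaf t. If some vertex occurs in no other bag,
-- its closed neighbourhood lies in the bag of t, and eliminating it leaves the
-- bags a decomposition. Otherwise the subtree of every vertex in the bag of t
-- contains the neighbour of t, and t can be dropped. Conversely, the sets
-- N[v_i] become a tree decomposition when the bag of v_i is attached to a bag
-- of the remaining decomposition that contains the clique N(v_i).

module Submission where

open import Defs
open import Data.Nat using (ℕ; _≤_)
open import Data.Fin.Subset using (⊤; ∣_∣)
open import Data.Product using (Σ; ∃; _×_)
open import Function.Bundles using (_⇔_)

import Data.Empty as Empty
open import Data.Fin using (Fin; zero; suc; toℕ)
import Data.Fin.Properties as Fin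
open import Data.Fin.Subset
  using (Subset; inside; outside; ⊥; ⁅_⁆; _∈_; _∉_; _⊆_; _⊂_; _∪_; _─_; _-_; Nonempty)
open import Data.Fin.Subset.Induction using (⊂-wellFounded)
open import Data.Fin.Subset.Properties
open import Data.Integer as ℤ using (1ℤ)
open import Data.List using (List; []; _∷_; [_]; _++_; _∷ʳ_; map; length; take)
open import Data.List.Extrema.Nat using (xs≤max; max≤v⁺; min≤xs)
open import Data.List.Membership.Propositional using () renaming (_∈_ to _∈ˡ_; _∉_ to _∉ˡ_)
open import Data.List.Membership.DecPropositional using () renaming (_∈?_ to mem?)
open import Data.List.Membership.Propositional.Properties
  using (∈-++⁺ˡ; ∈-++⁺ʳ; ∈-map⁺; ∈-filter⁺; ∈-∃++)
open import Data.List.Properties using (map-++; length-map; ++-assoc)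
open import Data.List.Relation.Binary.Disjoint.Propositional using (Disjoint)
open import Data.List.Relation.Unary.All as All using (All; []; _∷_)
import Data.List.Relation.Unary.All.Properties as All
open import Data.List.Relation.Unary.AllPairs using ([]; _∷_)
open import Data.List.Relation.Unary.Any using (here; there)
open import Data.List.Relation.Unary.Linked as Linked using (Linked; [-]; _∷_)
import Data.List.Relation.Unary.Linked.Properties as Linked
open import Data.List.Relation.Unary.Unique.Propositional using (Unique)
import Data.List.Relation.Unary.Unique.Propositional.Properties as Unique
open import Data.Nat using (zero; suc; _+_; _<_; z≤n; s≤s; s≤s⁻¹)
import Data.Nat.Properties as ℕ
open import Data.Product using (_,_; proj₁; proj₂)
open import Data.Sum using (_⊎_; inj₁; inj₂)
open import Data.Vec as Vec using ([]; _∷_)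
open import Data.Vec.Properties using (lookup⇒[]=; []=⇒lookup; lookup∘tabulate)
open import Function.Base using (_∘_; id)
open import Function.Bundles using (mk⇔; module Equivalence)
open import Induction.WellFounded using (Acc; acc)
open import Level using (0ℓ)
open import Relation.Binary using (Rel; Symmetric)
open import Relation.Binary.Construct.Closure.ReflexiveTransitive as Star
  using (Star; ε; _◅_; _◅◅_)
open import Relation.Binary.PropositionalEquality
  using (_≡_; _≢_; refl; sym; trans; cong; subst)
open import Relation.Nullary using (¬_; yes; no; ¬?; _×-dec_; contradiction)
open import Relation.Nullary.Decidable using (dec-true; decidable-stable)
open import Relation.Unary using (Pred; Decidable)

private variable
  m n : ℕ

-- Finite sets and lists

∈⟦⟧⁺ : ∀ {ℓ} {P : Pred (Fin n) ℓ} (P? : Decidable P) {x} → P x → x ∈ ⟦ P? ⟧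
∈⟦⟧⁺ P? {x} px = lookup⇒[]= x _ (trans (lookup∘tabulate _ x) (dec-true (P? x) px))

∈⟦⟧⁻ : ∀ {ℓ} {P : Pred (Fin n) ℓ} (P? : Decidable P) {x} → x ∈ ⟦ P? ⟧ → P x
∈⟦⟧⁻ P? {x} x∈ with P? x | trans (sym (lookup∘tabulate _ x)) ([]=⇒lookup x∈)
... | yes px | _ = px
... | no _   | ()

x∈p─q⇒x∉q : ∀ (p q : Subset n) {x} → x ∈ p ─ q → x ∉ q
x∈p─q⇒x∉q (inside  ∷ p) (outside ∷ q) Vec.here       ()
x∈p─q⇒x∉q (_ ∷ p)       (_ ∷ q)       (Vec.there x∈) (Vec.there x∈q) = x∈p─q⇒x∉q p q x∈ x∈q

x∈p-y⇒x≢y : ∀ {p : Subset n} {x y} → x ∈ p - y → x ≢ y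
x∈p-y⇒x≢y {p = p} {x} x∈ refl = x∈p─q⇒x∉q p ⁅ x ⁆ x∈ (x∈⁅x⁆ x)

x∈p-y⇒x∈p : ∀ {p : Subset n} {x y} → x ∈ p - y → x ∈ p
x∈p-y⇒x∈p {p = p} {y = y} = p─q⊆p p ⁅ y ⁆

∣p∪q∣≤∣p∣+∣q∣ : ∀ (p q : Subset n) → ∣ p ∪ q ∣ ≤ ∣ p ∣ + ∣ q ∣
∣p∪q∣≤∣p∣+∣q∣ []            []            = z≤n
∣p∪q∣≤∣p∣+∣q∣ (outside ∷ p) (outside ∷ q) = ∣p∪q∣≤∣p∣+∣q∣ p q
∣p∪q∣≤∣p∣+∣q∣ (outside ∷ p) (inside ∷ q)
  rewrite ℕ.+-suc ∣ p ∣ ∣ q ∣ = s≤s (∣p∪q∣≤∣p∣+∣q∣ p q)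
∣p∪q∣≤∣p∣+∣q∣ (inside ∷ p)  (outside ∷ q) = s≤s (∣p∪q∣≤∣p∣+∣q∣ p q)
∣p∪q∣≤∣p∣+∣q∣ (inside ∷ p)  (inside ∷ q)
  rewrite ℕ.+-suc ∣ p ∣ ∣ q ∣ = s≤s (ℕ.m≤n⇒m≤1+n (∣p∪q∣≤∣p∣+∣q∣ p q))

∈-subsets : ∀ (p : Subset n) → p ∈ˡ subsets n
∈-subsets []            = here refl
∈-subsets (outside ∷ p) = ∈-++⁺ˡ (∈-map⁺ (outside ∷_) (∈-subsets p))
∈-subsets {suc n} (inside ∷ p) =
  ∈-++⁺ʳ (map (outside ∷_) (subsets n)) (∈-map⁺ (inside ∷_) (∈-subsets p))

≤-maximum : ∀ (f : Fin m → ℕ) i → f i ≤ maximum f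
≤-maximum f = All.tabulate⁻ (xs≤max 0 _)

maximum-≤ : ∀ (f : Fin m → ℕ) {k} → (∀ i → f i ≤ k) → maximum f ≤ k
maximum-≤ f f≤k = max≤v⁺ z≤n (All.tabulate⁺ f≤k)

i-1≤k⇒i≤1+k : ∀ {i k} → ℤ.+ i ℤ.- 1ℤ ℤ.≤ ℤ.+ k → i ≤ suc k
i-1≤k⇒i≤1+k {zero}  _           = z≤n
i-1≤k⇒i≤1+k {suc i} (ℤ.+≤+ i≤k) = s≤s i≤k

i≤1+k⇒i-1≤k : ∀ {i k} → i ≤ suc k → ℤ.+ i ℤ.- 1ℤ ℤ.≤ ℤ.+ k
-- A largest bag of size zero gives width `-1`, which lies below every natural number.
i≤1+k⇒i-1≤k {zero}  _         = ℤ.-≤+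
i≤1+k⇒i-1≤k {suc i} (s≤s i≤k) = ℤ.+≤+ i≤k

AtMost-mono : ∀ {a p q} {A : Set a} {P : Pred A p} {Q : Pred A q} {c} →
              (∀ {x} → P x → Q x) → AtMost c Q → AtMost c P
AtMost-mono P⊆Q (xs , len , Q⊆xs) = xs , len , Q⊆xs ∘ P⊆Q

-- `subsets` enumerates every set of hyperedges, so `F` passes the filter and its size is among the
-- numbers whose minimum is taken.
coverNumber-≤ : ∀ (H : Hypergraph n) {S F} →
                Hypergraph.IsEdgeCover H S F → Hypergraph.coverNumber H S ≤ ∣ F ∣
coverNumber-≤ H {S} {F} cover = All.lookup (min≤xs _ _)
  (∈-map⁺ ∣_∣ (∈-filter⁺ (Hypergraph.isEdgeCover? H S) (∈-subsets F) cover))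

module _ {a} {A : Set a} where

  unique-++ˡ : ∀ (xs : List A) {ys} → Unique (xs ++ ys) → Unique xs
  unique-++ˡ []       _        = []
  unique-++ˡ (x ∷ xs) (x# ∷ u) = All.++⁻ˡ xs x# ∷ unique-++ˡ xs u

  unique-++⇒disjoint : ∀ (xs : List A) {ys} → Unique (xs ++ ys) → Disjoint xs ys
  unique-++⇒disjoint (x ∷ xs) (x# ∷ u) (here refl , z∈ys) =
    All.lookup (All.++⁻ʳ xs x#) z∈ys refl
  unique-++⇒disjoint (x ∷ xs) (x# ∷ u) (there z∈xs , z∈ys) =
    unique-++⇒disjoint xs u (z∈xs , z∈ys)

  module _ {r} {R : Rel A r} where

    -- Cuts a path behind `y` and closes it: with `w` the first vertex of the path, the result is
    -- the closed walk that `IsCycle` asks for.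
    linked-close : ∀ xs {y ys w} → Linked R (xs ++ y ∷ ys) → R y w →
                   Linked R ((xs ∷ʳ y) ∷ʳ w)
    linked-close []            _       Ryw = Ryw ∷ [-]
    linked-close (_ ∷ [])      (r ∷ l) Ryw = r ∷ linked-close [] l Ryw
    linked-close (_ ∷ x ∷ xs)  (r ∷ l) Ryw = r ∷ linked-close (x ∷ xs) l Ryw

    linked-pred : ∀ x xs {z zs} → Linked R (x ∷ xs ++ z ∷ zs) →
                  (xs ≡ [] × R x z) ⊎ ∃ λ y → y ∈ˡ xs × R y z
    linked-pred x []       (r ∷ _) = inj₁ (refl , r)
    linked-pred x (y ∷ ys) (_ ∷ l) with linked-pred y ys l
    ... | inj₁ (refl , Ryz)     = inj₂ (y , here refl , Ryz)
    ... | inj₂ (w , w∈ys , Rwz) = inj₂ (w , there w∈ys , Rwz)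

    linked-succ : ∀ xs {z ys} → Linked R (xs ++ z ∷ ys) → Linked R (z ∷ ys)
    linked-succ []           l       = l
    linked-succ (_ ∷ [])     (_ ∷ l) = l
    linked-succ (_ ∷ x ∷ xs) (_ ∷ l) = linked-succ (x ∷ xs) l

zero∉⇒map-suc : ∀ (xs : List (Fin (suc m))) → zero ∉ˡ xs → ∃ λ ys → xs ≡ map suc ys
zero∉⇒map-suc []           _  = [] , refl
zero∉⇒map-suc (zero ∷ xs)  0∉ = contradiction (here refl) 0∉
zero∉⇒map-suc (suc x ∷ xs) 0∉ with zero∉⇒map-suc xs (0∉ ∘ there)
... | ys , refl = x ∷ ys , refl

-- Connected sets of nodes

-- This has the shape of the adjacency in `induced`, so for `P = _∈ X` a walk here is definitionally
-- a walk in the induced subgraph.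
Within : ∀ {a} {A : Set a} → Rel A 0ℓ → Pred A 0ℓ → Rel A 0ℓ
Within R P x y = R x y × P x × P y

Connected : ∀ {a} {A : Set a} → Rel A 0ℓ → Pred A 0ℓ → Set a
Connected R P = ∀ {x y} → P x → P y → Star (Within R P) x y

connected-resp : ∀ {a} {A : Set a} {R : Rel A 0ℓ} {P Q : Pred A 0ℓ} →
                 (∀ {x} → P x → Q x) → (∀ {x} → Q x → P x) →
                 Connected R P → Connected R Q
connected-resp P⇒Q Q⇒P con qx qy =
  Star.map (λ (r , px , py) → r , P⇒Q px , P⇒Q py) (con (Q⇒P qx) (Q⇒P qy))

-- A walk that enters t leaves it to where it came from.
connected-delete-leaf : ∀ {R : Rel (Fin m) 0ℓ} {P : Pred (Fin m) 0ℓ} {t} → Symmetric R →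
                        (∀ {p q} → P p → P q → R t p → R t q → p ≡ q) →
                        Connected R P → Connected R (λ x → P x × x ≢ t)
connected-delete-leaf {R = R} {P} {t} R-sym leaf con (px , x≢t) (py , y≢t) =
  bypass (con px py) x≢t y≢t
  where
  bypass : ∀ {x y} → Star (Within R P) x y → x ≢ t → y ≢ t →
           Star (Within R (λ x → P x × x ≢ t)) x y
  bypass ε _ _ = ε
  bypass (_◅_ {j = z} (r , px , pz) w) x≢t y≢t with z Fin.≟ t
  ... | no z≢t = (r , (px , x≢t) , (pz , z≢t)) ◅ bypass w z≢t y≢t
  bypass ((r , px , pz) ◅ ε) x≢t y≢t | yes refl = contradiction refl y≢t
  bypass ((r , px , pz) ◅ (r′ , _ , pz′) ◅ w) x≢t y≢t | yes refl
    with refl ← leaf px pz′ (R-sym r) r′ = bypass w x≢t y≢t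

-- Leaves of forests

module _ {V : Subset m} (T : Graph V) where
  open Graph T

  Acyclic : Set
  Acyclic = ∀ x xs → ¬ IsCycle T x xs

  -- An isolated node counts as a leaf, so that a single remaining node is one too.
  LeafIn : Subset m → Fin m → Set
  LeafIn W t = ∀ {a b} → a ∈ W → b ∈ W → t ~ a → t ~ b → a ≡ b

  -- The path from `x` to `y` closes through the edge between them. Since `y` is not the vertex next
  -- to `x` on the path, at least three vertices are involved.
  chord⇒cycle : ∀ {x y} xs → Unique (x ∷ xs) → Linked _~_ (x ∷ xs) → x ~ y →
                y ∈ˡ xs → y ∉ˡ take 1 xs → ∃ λ ys → IsCycle T x ys
  chord⇒cycle (z ∷ zs) _ _ _ (here refl) y∉ = contradiction (here refl) y∉
  chord⇒cycle {x} {y} (z ∷ zs) u l x~y (there y∈zs) _ with ∈-∃++ y∈zs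
  ... | as , bs , refl = z ∷ as ∷ʳ y , s≤s (nonempty as) , unique , linked-close (x ∷ z ∷ as) l (~-sym x~y)
    where
    nonempty : ∀ as → 1 ≤ length (as ∷ʳ y)
    nonempty []      = s≤s z≤n
    nonempty (_ ∷ _) = s≤s z≤n
    unique : Unique (x ∷ z ∷ as ∷ʳ y)
    unique = unique-++ˡ (x ∷ z ∷ as ∷ʳ y)
      (subst (λ ws → Unique (x ∷ z ∷ ws)) (sym (++-assoc as [ y ] bs)) u)

  -- Grow a path inside `W`, newest node first. A further neighbour of its end is either on the
  -- path, which closes a cycle, or extends it. The nodes off the path run out, and an end that
  -- cannot be extended is a leaf.
  leaf-exists : Acyclic → ∀ {W} → Nonempty W → ∃ λ t → t ∈ W × LeafIn W t
  leaf-exists acyclic {W} (x₀ , x₀∈W) =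
    extend (⊂-wellFounded W) x₀ [] x₀∈W ([] ∷ []) [-] (λ y∈W → inj₁ y∈W)
    where
    -- U contains the nodes of W off the path x ∷ xs.
    extend : ∀ {U} → Acc _⊂_ U → ∀ x xs → x ∈ W → Unique (x ∷ xs) → Linked _~_ (x ∷ xs) →
             (∀ {y} → y ∈ W → y ∈ U ⊎ y ∈ˡ x ∷ xs) → ∃ λ t → t ∈ W × LeafIn W t
    extend {U} (acc rec) x xs x∈W u l off
      -- `take 1 xs` holds the node from which the path came to `x`, and nothing for the one-node
      -- path.
      with Fin.any? (λ y → (y ∈? W) ×-dec (x ~? y) ×-dec ¬? (mem? Fin._≟_ y (take 1 xs)))
    ... | no none = x , x∈W , leaf
      where
      known : ∀ {a} → a ∈ W → x ~ a → a ∈ˡ take 1 xs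
      known {a} a∈W x~a =
        decidable-stable (mem? Fin._≟_ a (take 1 xs)) (λ a∉ → none (a , a∈W , x~a , a∉))
      same : ∀ {a b} zs → a ∈ˡ take 1 zs → b ∈ˡ take 1 zs → a ≡ b
      same (_ ∷ _) (here refl) (here refl) = refl
      leaf : LeafIn W x
      leaf a∈W b∈W x~a x~b = same xs (known a∈W x~a) (known b∈W x~b)
    ... | yes (y , y∈W , x~y , y∉) with mem? Fin._≟_ y (x ∷ xs)
    ... | yes (here refl)  = contradiction x~y (~-irr refl)
    ... | yes (there y∈xs) = contradiction (proj₂ (chord⇒cycle xs u l x~y y∈xs y∉)) (acyclic x _)
    ... | no y∉path with off y∈W
    ... | inj₂ y∈path = contradiction y∈path y∉path
    ... | inj₁ y∈U = extend (rec (x∈p⇒p-x⊂p y∈U)) y (x ∷ xs) y∈W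
      (All.tabulate (λ { z∈ refl → y∉path z∈ }) ∷ u) (~-sym x~y ∷ l) off′
      where
      off′ : ∀ {z} → z ∈ W → z ∈ U - y ⊎ z ∈ˡ y ∷ x ∷ xs
      off′ {z} z∈W with z Fin.≟ y | off z∈W
      ... | yes z≡y | _           = inj₂ (here z≡y)
      ... | no _    | inj₂ z∈path = inj₂ (there z∈path)
      ... | no z≢y  | inj₁ z∈U    = inj₁ (x∈p∧x≢y⇒x∈p-y z∈U z≢y)

  -- The vertices before and after `z` on a cycle would both equal `s`, although a cycle has
  -- distinct vertices.
  leaf∉cycle : ∀ {z s x xs} → (∀ {a} → z ~ a → a ≡ s) → IsCycle T x xs → z ∉ˡ x ∷ xs
  leaf∉cycle {xs = []}          leaf (() , _)
  leaf∉cycle {xs = _ ∷ []}      leaf (s≤s () , _)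
  leaf∉cycle {x = x} {b ∷ b′ ∷ bs} leaf (_ , u , (x~b ∷ l)) (here refl)
    with leaf x~b | linked-pred b (b′ ∷ bs) l
  ... | refl | inj₂ (a , a∈ , a~x) with refl ← leaf (~-sym a~x) | _ ∷ b# ∷ _ ← u =
    All.lookup b# a∈ refl
  leaf∉cycle {z} {x = x} {xs} leaf (2≤ , u , l) (there z∈xs) with ∈-∃++ z∈xs
  ... | as , bs , refl = absurd as bs 2≤ u l′ (linked-pred x as l′) (linked-succ (x ∷ as) l′)
    where
    l′ : Linked _~_ (x ∷ as ++ z ∷ (bs ∷ʳ x))
    l′ = subst (λ ws → Linked _~_ (x ∷ ws)) (++-assoc as (z ∷ bs) [ x ]) l
    absurd : ∀ as bs → 2 ≤ length (as ++ z ∷ bs) → Unique (x ∷ as ++ z ∷ bs) →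
             Linked _~_ (x ∷ as ++ z ∷ (bs ∷ʳ x)) →
             (as ≡ [] × x ~ z) ⊎ (∃ λ y → y ∈ˡ as × y ~ z) → ¬ Linked _~_ (z ∷ (bs ∷ʳ x))
    -- The successor of `z` is the head of `bs`, or `x` if `bs` is empty; the predecessor is in
    -- `as`, or is `x` if `as` is empty. If both are empty, the list is too short for a cycle.
    absurd as [] 2≤ _ _ (inj₁ (refl , _)) _ = contradiction 2≤ (λ { (s≤s ()) })
    absurd as [] _ (x# ∷ _) _ (inj₂ (a , a∈ , a~z)) (z~x ∷ _) =
      All.lookup x# (∈-++⁺ˡ a∈) (trans (leaf z~x) (sym (leaf (~-sym a~z))))
    absurd as (b ∷ bs) _ (x# ∷ _) _ (inj₁ (refl , x~z)) (z~b ∷ _) =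
      All.lookup x# (there (here refl)) (trans (leaf (~-sym x~z)) (sym (leaf z~b)))
    absurd as (b ∷ bs) _ (_ ∷ u) _ (inj₂ (a , a∈ , a~z)) (z~b ∷ _) =
      unique-++⇒disjoint as u
        (subst (_∈ˡ as) (trans (leaf (~-sym a~z)) (sym (leaf z~b))) a∈ , there (here refl))

-- Elimination orderings from decompositions

cons-ordering : ∀ {V : Subset n} {v} → v ∈ V →
                EliminationOrdering (V - v) → EliminationOrdering V
cons-ordering {V = V} {v} v∈V σ = record
  { order      = v ∷ order
  ; unique     = All.tabulate (λ { w∈ refl → x∈p-y⇒x≢y {p = V} (to enumerates w∈) refl }) ∷ unique
  ; enumerates = mk⇔ (λ { (here refl) → v∈V ; (there w∈) → x∈p-y⇒x∈p (to enumerates w∈) })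
                     split
  }
  where
  open EliminationOrdering σ
  open Equivalence
  split : ∀ {w} → w ∈ V → w ∈ˡ v ∷ order
  split {w} w∈V with w Fin.≟ v
  ... | yes w≡v = here w≡v
  ... | no w≢v  = there (from enumerates (x∈p∧x≢y⇒x∈p-y w∈V w≢v))

module _ (T : Graph {m} ⊤) (acyclic : Acyclic T) (χ : Fin m → Subset n) where
  open Graph T using () renaming (_~_ to _~ᵀ_; ~-sym to ~ᵀ-sym)

  -- The bags of the nodes in W decompose G; they may contain further vertices.
  record Decomposes (W : Subset m) {V : Subset n} (G : Graph V) : Set where
    open Graph G
    field
      vertex-in : ∀ {v} → v ∈ V → ∃ λ t → t ∈ W × v ∈ χ t
      edge-in   : ∀ {x y} → x ~ y → ∃ λ t → t ∈ W × x ∈ χ t × y ∈ χ t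
      connected : ∀ {v} → v ∈ V → Connected _~ᵀ_ (λ t → t ∈ W × v ∈ χ t)

  -- The edges that elimination adds join neighbours of `v`, and those share the bag of `t`. The
  -- bags themselves stay as they are, `v` included.
  eliminate-decomposes : ∀ {W V} {G : Graph V} {v t} → t ∈ W →
                         Graph.N[_] G v ⊆ χ t → Decomposes W G → Decomposes W (eliminate G v)
  eliminate-decomposes {G = G} {v} {t} t∈W N⊆χ D = record
    { vertex-in = vertex-in ∘ x∈p-y⇒x∈p
    ; edge-in   = λ
        { (_ , _ , inj₁ x~y)             → edge-in x~y
        ; (_ , _ , inj₂ (_ , v~x , v~y)) → t , t∈W , N⊆χ (nbr v~x) , N⊆χ (nbr v~y)
        }
    ; connected = connected ∘ x∈p-y⇒x∈p
    }
    where
    open Decomposes D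
    open Graph G
    nbr : ∀ {x} → v ~ x → x ∈ N[ v ]
    nbr v~x = x∈p∪q⁺ (inj₁ (∈⟦⟧⁺ (v ~?_) v~x))

  -- A walk from `t` to another node holding a vertex starts with a step to a neighbour of `t`,
  -- which therefore holds the vertex as well. The leaf has only one such neighbour in `W`, so both
  -- ends of an edge from the bag of `t` meet there.
  delete-leaf-decomposes : ∀ {W V} {G : Graph V} {t} → LeafIn T W t →
    (∀ {v} → v ∈ V → v ∈ χ t → ∃ λ s → s ∈ W × v ∈ χ s × s ≢ t) →
    t ∈ W → Decomposes W G → Decomposes (W - t) G
  delete-leaf-decomposes {W} {V} {G} {t} leaf elsewhere t∈W D = record
    { vertex-in = vertex-in′
    ; edge-in   = edge-in′
    ; connected = λ v∈V → connected-resp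
        (λ ((s∈W , v∈χs) , s≢t) → x∈p∧x≢y⇒x∈p-y s∈W s≢t , v∈χs)
        (λ (s∈ , v∈χs) → (x∈p-y⇒x∈p s∈ , v∈χs) , x∈p-y⇒x≢y {p = W} s∈)
        (connected-delete-leaf ~ᵀ-sym (λ (p∈ , _) (q∈ , _) → leaf p∈ q∈) (connected v∈V))
    }
    where
    open Decomposes D
    open Graph G

    toward-t : ∀ {v s} → v ∈ V → v ∈ χ t → s ∈ W → v ∈ χ s → s ≢ t →
               ∃ λ r → t ~ᵀ r × r ∈ W × v ∈ χ r
    toward-t v∈V v∈χt s∈W v∈χs s≢t with connected v∈V (t∈W , v∈χt) (s∈W , v∈χs)
    ... | ε                         = contradiction refl s≢t
    ... | (t~r , _ , r∈W , v∈χr) ◅ _ = _ , t~r , r∈W , v∈χr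

    neighbour : ∀ {v} → v ∈ V → v ∈ χ t → ∃ λ r → t ~ᵀ r × r ∈ W × v ∈ χ r
    neighbour v∈V v∈χt with elsewhere v∈V v∈χt
    ... | s , s∈W , v∈χs , s≢t = toward-t v∈V v∈χt s∈W v∈χs s≢t

    remains : ∀ {r} → t ~ᵀ r → r ∈ W → r ∈ W - t
    remains t~r r∈W = x∈p∧x≢y⇒x∈p-y r∈W (λ { refl → Graph.~-irr T refl t~r })

    vertex-in′ : ∀ {v} → v ∈ V → ∃ λ s → s ∈ W - t × v ∈ χ s
    vertex-in′ v∈V with vertex-in v∈V
    ... | s , s∈W , v∈χs with s Fin.≟ t
    ... | no s≢t = s , x∈p∧x≢y⇒x∈p-y s∈W s≢t , v∈χs
    ... | yes refl with neighbour v∈V v∈χs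
    ... | r , t~r , r∈W , v∈χr = r , remains t~r r∈W , v∈χr

    edge-in′ : ∀ {x y} → x ~ y → ∃ λ s → s ∈ W - t × x ∈ χ s × y ∈ χ s
    edge-in′ x~y with edge-in x~y
    ... | s , s∈W , x∈χs , y∈χs with s Fin.≟ t
    ... | no s≢t = s , x∈p∧x≢y⇒x∈p-y s∈W s≢t , x∈χs , y∈χs
    ... | yes refl with neighbour (~-left x~y) x∈χs | neighbour (~-left (~-sym x~y)) y∈χs
    ... | r , t~r , r∈W , x∈χr | r′ , t~r′ , r′∈W , y∈χr′
      with refl ← leaf r∈W r′∈W t~r t~r′ = r , remains t~r r∈W , x∈χr , y∈χr′

  OrderingInBags : ∀ {V} → Graph V → Set
  OrderingInBags {V} G =
    Σ (EliminationOrdering V) λ σ → ∀ p → ∃ λ t → elimN[_] G σ p ⊆ χ t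

  -- Recursion on `k`, a strict bound on nodes plus vertices: dropping a leaf lowers the first
  -- count, eliminating a vertex the second. The bags never change, so those found later are bags of
  -- the original tree.
  decomposition⇒ordering : ∀ {k W V} {G : Graph V} → ∣ W ∣ + ∣ V ∣ < k →
                           Decomposes W G → OrderingInBags G
  decomposition⇒ordering {suc k} {W} {V} {G} size D with nonempty? W
  ... | no W-empty = record { order = [] ; unique = [] ; enumerates = mk⇔ (λ ()) none } , λ ()
    where
    none : ∀ {v} → v ∈ V → v ∈ˡ []
    none v∈V with Decomposes.vertex-in D v∈V
    ... | t , t∈W , _ = contradiction (t , t∈W) W-empty
  ... | yes W-nonempty with leaf-exists T acyclic W-nonempty
  ... | t , t∈W , leaf = step
    where
    open Decomposes D
    open Graph G
    elsewhere? : ∀ v → _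
    elsewhere? v = Fin.any? λ s → (s ∈? W) ×-dec (v ∈? χ s) ×-dec ¬? (s Fin.≟ t)

    step : OrderingInBags G
    step with Fin.any? (λ v → (v ∈? V) ×-dec (v ∈? χ t) ×-dec ¬? (elsewhere? v))
    ... | no ¬private = decomposition⇒ordering
      (ℕ.<-≤-trans (ℕ.+-monoˡ-< ∣ V ∣ (x∈p⇒∣p-x∣<∣p∣ t∈W)) (s≤s⁻¹ size))
      (delete-leaf-decomposes leaf
        (λ {v} v∈V v∈χt → decidable-stable (elsewhere? v) (λ ¬e → ¬private (v , v∈V , v∈χt , ¬e)))
        t∈W D)
    -- The stages after the first are those of `eliminate G v`, so positions in the tail need no
    -- conversion.
    ... | yes (v , v∈V , v∈χt , ¬elsewhere) = cons-ordering v∈V σ , λ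
      { zero    → t , N⊆χ
      ; (suc p) → in-bag p
      }
      where
      N⊆χ : N[ v ] ⊆ χ t
      N⊆χ {x} x∈N with x∈p∪q⁻ (N v) ⁅ v ⁆ x∈N
      ... | inj₂ x∈v with refl ← x∈⁅y⁆⇒x≡y v x∈v = v∈χt
      -- The edge from `v` to `x` lies in some bag; as that bag holds `v`, it is the bag of `t`.
      ... | inj₁ x∈Nv with edge-in (∈⟦⟧⁻ (v ~?_) x∈Nv)
      ... | s , s∈W , v∈χs , x∈χs with s Fin.≟ t
      ... | yes refl = x∈χs
      ... | no s≢t   = contradiction (s , s∈W , v∈χs , s≢t) ¬elsewhere

      rest : OrderingInBags (eliminate G v)
      rest = decomposition⇒ordering
        (ℕ.<-≤-trans (ℕ.+-monoʳ-< ∣ W ∣ (x∈p⇒∣p-x∣<∣p∣ v∈V)) (s≤s⁻¹ size))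
        (eliminate-decomposes t∈W N⊆χ D)
      σ      = proj₁ rest
      in-bag = proj₂ rest

-- The family `E` is general in order to serve both for the edges of the primal graph and for the
-- hyperedges of the instance.
treeDecomposition⇒ordering :
  ∀ {E} (G : Graph {n} ⊤) → (∀ {x y} → Graph._~_ G x y → ∃ λ e → E e × x ∈ e × y ∈ e) →
  (D : TreeDecomposition ⊤ E) →
  Σ (EliminationOrdering ⊤) λ σ → ∀ p → ∃ λ t → elimN[_] G σ p ⊆ TreeDecomposition.χ D t
treeDecomposition⇒ordering G edge-of D =
  decomposition⇒ordering T (IsTree.acyclic T-tree) χ {W = ⊤} ℕ.≤-refl record
    { vertex-in = λ {v} v∈V → let t , t∈ = IsTree.nonempty (subtree v∈V) in
        t , ∈⊤ , ∈⟦⟧⁻ (λ t → v ∈? χ t) (proj₂ (x∈p∩q⁻ ⊤ _ t∈))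
    ; edge-in   = λ x~y → let e , Ee , x∈e , y∈e = edge-of x~y ; t , e⊆χ = edge-in Ee in
        t , ∈⊤ , e⊆χ x∈e , e⊆χ y∈e
    ; connected = λ {v} v∈V (_ , v∈χx) (_ , v∈χy) → let in-bag? = λ t → v ∈? χ t in
        Star.map (λ (r , x∈ , y∈) → r , (∈⊤ , ∈⟦⟧⁻ in-bag? x∈) , (∈⊤ , ∈⟦⟧⁻ in-bag? y∈))
          (IsTree.connected (subtree v∈V)
            (x∈p∩q⁺ (∈⊤ , ∈⟦⟧⁺ in-bag? v∈χx)) (x∈p∩q⁺ (∈⊤ , ∈⟦⟧⁺ in-bag? v∈χy)))
    }
  where open TreeDecomposition D

-- Decompositions from elimination orderings

induced-tree : ∀ {V : Subset m} (T : Graph V) → Acyclic T → ∀ X → (∃ λ x → x ∈ V × x ∈ X) →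
               Connected (Graph._~_ T) (_∈ X) → IsTree (induced T X)
induced-tree {V = V} T acyclic X (x , x∈V , x∈X) connected = record
  { nonempty  = x , x∈p∩q⁺ (x∈V , x∈X)
  ; connected = λ x∈ y∈ → connected (proj₂ (x∈p∩q⁻ V X x∈)) (proj₂ (x∈p∩q⁻ V X y∈))
  ; acyclic   = λ x xs (2≤ , u , l) → acyclic x xs (2≤ , u , Linked.map proj₁ l)
  }

module _ (T : Graph {m} ⊤) (t : Fin m) where
  open Graph T

  addLeaf : Graph {suc m} ⊤
  addLeaf = record
    { _~_    = Adj
    ; _~?_   = λ
        { zero    zero    → no λ ()
        ; zero    (suc y) → y Fin.≟ t
        ; (suc x) zero    → x Fin.≟ t
        ; (suc x) (suc y) → x ~? y
        }
    ; ~-sym  = λ {x} {y} → Adj-sym x y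
    ; ~-irr  = λ { {zero} refl () ; {suc x} refl x~x → ~-irr refl x~x }
    ; ~-left = λ _ → ∈⊤
    }
    where
    Adj : Rel (Fin (suc m)) 0ℓ
    Adj zero    zero    = Empty.⊥
    Adj zero    (suc y) = y ≡ t
    Adj (suc x) zero    = x ≡ t
    Adj (suc x) (suc y) = x ~ y
    Adj-sym : ∀ x y → Adj x y → Adj y x
    Adj-sym zero    (suc y) y≡t = y≡t
    Adj-sym (suc x) zero    x≡t = x≡t
    Adj-sym (suc x) (suc y) x~y = ~-sym x~y

  -- The new node `zero` has a single neighbour, so no cycle visits it, and a cycle avoiding it is
  -- the image under `suc` of a cycle of `T`.
  addLeaf-acyclic : Acyclic T → Acyclic addLeaf
  addLeaf-acyclic acyclic x xs cycle@(2≤ , u , l)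
    with zero∉⇒map-suc (x ∷ xs) (leaf∉cycle addLeaf (λ { {suc _} refl → refl }) cycle)
  ... | y ∷ ys , refl = acyclic y ys
    ( subst (2 ≤_) (length-map suc ys) 2≤
    , Unique.map⁻ u
    , Linked.map⁻ (subst (λ ws → Linked (Graph._~_ addLeaf) (suc y ∷ ws))
        (sym (map-++ suc ys [ y ])) l)
    )

  -- If the new node satisfies `P`, so does its only neighbour, and walks from or to the new node
  -- can use the edge between them.
  addLeaf-connected : ∀ {P : Pred (Fin (suc m)) 0ℓ} → (P zero → P (suc t)) →
                      Connected _~_ (P ∘ suc) → Connected (Graph._~_ addLeaf) P
  addLeaf-connected attach con {zero}  {zero}  _  _  = ε
  addLeaf-connected attach con {zero}  {suc y} p₀ py =
    (refl , p₀ , attach p₀) ◅ Star.gmap suc id (con (attach p₀) py)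
  addLeaf-connected attach con {suc x} {zero}  px p₀ =
    Star.gmap suc id (con px (attach p₀)) ◅◅ (refl , attach p₀ , p₀) ◅ ε
  addLeaf-connected attach con {suc x} {suc y} px py = Star.gmap suc id (con px py)

-- Cliques take the place of edges in the construction: the recursive call then supplies a bag
-- around the clique left by the eliminated vertex, and both edges and scopes are cliques.
IsClique : ∀ {V : Subset n} → Graph V → Pred (Subset n) 0ℓ
IsClique {V = V} G K = K ⊆ V × (∀ {x y} → x ∈ K → y ∈ K → x ≢ y → Graph._~_ G x y)

module _ {V : Subset n} (G : Graph V) where
  open Graph G

  N⊆V : ∀ {v} → N v ⊆ V
  N⊆V {v} x∈N = ~-left (~-sym (∈⟦⟧⁻ (v ~?_) x∈N))

  N[]⊆V : ∀ {v} → v ∈ V → N[ v ] ⊆ V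
  N[]⊆V {v} v∈V x∈ with x∈p∪q⁻ (N v) ⁅ v ⁆ x∈
  ... | inj₁ x∈N = N⊆V x∈N
  ... | inj₂ x∈v with refl ← x∈⁅y⁆⇒x≡y v x∈v = v∈V

  v∉N : ∀ {v} → v ∉ N v
  v∉N {v} v∈N = ~-irr refl (∈⟦⟧⁻ (v ~?_) v∈N)

  v∈N[] : ∀ {v} → v ∈ N[ v ]
  v∈N[] {v} = q⊆p∪q (N v) ⁅ v ⁆ (x∈⁅x⁆ v)

  N⊆N[] : ∀ {v} → N v ⊆ N[ v ]
  N⊆N[] {v} = p⊆p∪q ⁅ v ⁆

  -- `v` belongs to the closed neighbourhood only. Together with the next bound this accounts for
  -- the `-1` in the width of a decomposition.
  ∣N∣<∣N[]∣ : ∀ v → ∣ N v ∣ < ∣ N[ v ] ∣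
  ∣N∣<∣N[]∣ v = p⊂q⇒∣p∣<∣q∣ (N⊆N[] , v , v∈N[] , v∉N)

  ∣N[]∣≤1+∣N∣ : ∀ v → ∣ N[ v ] ∣ ≤ suc ∣ N v ∣
  ∣N[]∣≤1+∣N∣ v = ℕ.≤-trans (∣p∪q∣≤∣p∣+∣q∣ (N v) ⁅ v ⁆)
    (ℕ.≤-reflexive (trans (cong (∣ N v ∣ +_) (∣⁅x⁆∣≡1 v)) (ℕ.+-comm ∣ N v ∣ 1)))

  N-clique-eliminate : ∀ v → IsClique (eliminate G v) (N v)
  N-clique-eliminate v =
    (λ x∈N → x∈p∧x≢y⇒x∈p-y (N⊆V x∈N) (≢v x∈N)) ,
    λ x∈N y∈N x≢y →
      ≢v x∈N , ≢v y∈N , inj₂ (x≢y , ∈⟦⟧⁻ (v ~?_) x∈N , ∈⟦⟧⁻ (v ~?_) y∈N)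
    where
    ≢v : ∀ {x} → x ∈ N v → x ≢ v
    ≢v x∈N refl = v∉N x∈N

  clique∋v⇒⊆N[] : ∀ {K v} → IsClique G K → v ∈ K → K ⊆ N[ v ]
  clique∋v⇒⊆N[] {v = v} (_ , adj) v∈K {x} x∈K with x Fin.≟ v
  ... | yes refl = v∈N[]
  ... | no x≢v   = N⊆N[] (∈⟦⟧⁺ (v ~?_) (adj v∈K x∈K (x≢v ∘ sym)))

  clique∌v⇒clique-eliminate : ∀ {K v} → IsClique G K → v ∉ K → IsClique (eliminate G v) K
  clique∌v⇒clique-eliminate {K} {v} (K⊆V , adj) v∉K =
    (λ x∈K → x∈p∧x≢y⇒x∈p-y (K⊆V x∈K) (≢v x∈K)) ,
    λ x∈K y∈K x≢y → ≢v x∈K , ≢v y∈K , inj₁ (adj x∈K y∈K x≢y)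
    where
    ≢v : ∀ {x} → x ∈ K → x ≢ v
    ≢v x∈K refl = v∉K x∈K

-- A tree must have a node, so the empty vertex set gets one node with an empty bag; the only clique
-- is then the empty one.
trivialDecomposition : ∀ {V : Subset n} (G : Graph V) → (∀ {v} → v ∉ V) →
                       TreeDecomposition V (IsClique G)
trivialDecomposition G V-empty = record
  { nodeCount = 1
  ; T         = T
  ; T-tree    = record
      { nonempty  = zero , ∈⊤
      ; connected = λ { {zero} {zero} _ _ → ε }
      ; acyclic   = λ { x []      (() , _)
                      ; x (_ ∷ _) (_ , _ , () ∷ _) }
      }
  ; χ         = λ _ → ⊥
  ; χ⊆V       = λ _ x∈⊥ → contradiction x∈⊥ ∉⊥
  ; edge-in   = λ (K⊆V , _) → zero , λ x∈K → contradiction (K⊆V x∈K) V-empty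
  ; subtree   = λ v∈V → contradiction v∈V V-empty
  }
  where
  T : Graph {1} ⊤
  T = record
    { _~_    = λ _ _ → Empty.⊥
    ; _~?_   = λ _ _ → no λ ()
    ; ~-sym  = λ ()
    ; ~-irr  = λ _ ()
    ; ~-left = λ ()
    }

module _ {V : Subset n} (G : Graph V) {v} (v∈V : v ∈ V)
         (D : TreeDecomposition (V - v) (IsClique (eliminate G v))) where
  open Graph G
  open TreeDecomposition D

  -- Old bags lie in `V - v`, so `v` occurs in the new bag only. Any other vertex of the new bag is
  -- in `N v`, hence in the bag of the node `t` to which the new node is attached, and its subtree
  -- stays connected.
  consDecomposition : TreeDecomposition V (IsClique G)
  consDecomposition = record
    { nodeCount = suc nodeCount
    ; T         = T′
    ; T-tree    = record
        { nonempty  = zero , ∈⊤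
        ; connected = λ _ _ → Star.map proj₁
            (addLeaf-connected T t {P = _∈ ⊤} (λ _ → ∈⊤)
              (λ _ _ → Star.map (λ r → r , ∈⊤ , ∈⊤) (IsTree.connected T-tree ∈⊤ ∈⊤)) ∈⊤ ∈⊤)
        ; acyclic   = acyclic′
        }
    ; χ         = χ′
    ; χ⊆V       = λ { zero → N[]⊆V G v∈V ; (suc s) → x∈p-y⇒x∈p ∘ χ⊆V s }
    ; edge-in   = clique-in
    ; subtree   = λ {u} u∈V → induced-tree T′ acyclic′ ⟦ (λ s → u ∈? χ′ s) ⟧
        (let s , u∈ = somewhere u∈V in s , ∈⊤ , ∈⟦⟧⁺ (λ s → u ∈? χ′ s) u∈)
        (connected-resp (∈⟦⟧⁺ (λ s → u ∈? χ′ s)) (∈⟦⟧⁻ (λ s → u ∈? χ′ s)) (connected′ u∈V))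
    }
    where
    -- Elimination turns `N v` into a clique, so some old bag contains it.
    hub : ∃ λ t → N v ⊆ χ t
    hub = edge-in (N-clique-eliminate G v)
    t   = proj₁ hub
    T′  = addLeaf T t
    acyclic′ = addLeaf-acyclic T t (IsTree.acyclic T-tree)

    χ′ : Fin (suc nodeCount) → Subset _
    χ′ zero    = N[ v ]
    χ′ (suc s) = χ s

    clique-in : ∀ {K} → IsClique G K → ∃ λ s → K ⊆ χ′ s
    -- A clique through `v` lies in the new bag; any other survives the elimination and already has
    -- a bag.
    clique-in {K} clique with v ∈? K
    ... | yes v∈K = zero , clique∋v⇒⊆N[] G clique v∈K
    ... | no v∉K with edge-in (clique∌v⇒clique-eliminate G clique v∉K)
    ... | s , K⊆χ = suc s , K⊆χ

    old : ∀ {u} → u ∈ V → u ≢ v → ∃ λ s → u ∈ χ s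
    old {u} u∈V u≢v with IsTree.nonempty (subtree (x∈p∧x≢y⇒x∈p-y u∈V u≢v))
    ... | s , s∈ = s , ∈⟦⟧⁻ (λ s → u ∈? χ s) (proj₂ (x∈p∩q⁻ ⊤ _ s∈))

    somewhere : ∀ {u} → u ∈ V → ∃ λ s → u ∈ χ′ s
    somewhere {u} u∈V with u Fin.≟ v
    ... | yes refl = zero , v∈N[] G
    ... | no u≢v with old u∈V u≢v
    ... | s , u∈χs = suc s , u∈χs

    only-new-node : Connected (Graph._~_ T′) (λ s → v ∈ χ′ s)
    only-new-node {zero}  {zero}  _   _   = ε
    only-new-node {suc x} {_}     v∈x _   = contradiction refl (x∈p-y⇒x≢y {p = V} (χ⊆V x v∈x))
    only-new-node {zero}  {suc y} _   v∈y = contradiction refl (x∈p-y⇒x≢y {p = V} (χ⊆V y v∈y))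

    connected′ : ∀ {u} → u ∈ V → Connected (Graph._~_ T′) (λ s → u ∈ χ′ s)
    connected′ {u} u∈V with u Fin.≟ v
    ... | yes refl = only-new-node
    ... | no u≢v = addLeaf-connected T t attach λ u∈x u∈y →
      Star.map (λ (r , x∈ , y∈) → r , ∈⟦⟧⁻ in-bag? x∈ , ∈⟦⟧⁻ in-bag? y∈)
        (IsTree.connected (subtree (x∈p∧x≢y⇒x∈p-y u∈V u≢v))
          (x∈p∩q⁺ (∈⊤ , ∈⟦⟧⁺ in-bag? u∈x)) (x∈p∩q⁺ (∈⊤ , ∈⟦⟧⁺ in-bag? u∈y)))
      where
      in-bag? : Decidable (λ s → u ∈ χ s)
      in-bag? s = u ∈? χ s
      attach : u ∈ N[ v ] → u ∈ χ t
      attach u∈N with x∈p∪q⁻ (N v) ⁅ v ⁆ u∈N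
      ... | inj₁ u∈Nv = proj₂ hub u∈Nv
      ... | inj₂ u∈v  = contradiction (x∈⁅y⁆⇒x≡y v u∈v) u≢v

-- The bags are identified exactly, so that bounds on closed neighbourhoods become bounds on bags by
-- rewriting. The alternative `⊥` comes from the node that remains once all vertices are eliminated.
ordering⇒cliqueDecomposition :
  ∀ {V : Subset n} (G : Graph V) (σ : EliminationOrdering V) →
  Σ (TreeDecomposition V (IsClique G)) λ D → let open TreeDecomposition D in
    ∀ t → χ t ≡ ⊥ ⊎ ∃ λ p → χ t ≡ elimN[_] G σ p
ordering⇒cliqueDecomposition G σ = go _ G (unique σ) (λ {v} → enumerates σ {v})
  where
  open EliminationOrdering
  open Equivalence
  go : ∀ vs {V : Subset _} (G : Graph V) (u : Unique vs) (e : ∀ {v} → v ∈ˡ vs ⇔ v ∈ V) →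
       let σ = record { order = vs ; unique = u ; enumerates = e } in
       Σ (TreeDecomposition V (IsClique G)) λ D → let open TreeDecomposition D in
         ∀ t → χ t ≡ ⊥ ⊎ ∃ λ p → χ t ≡ elimN[_] G σ p
  go [] G _ e =
    trivialDecomposition G (λ v∈V → contradiction (from e v∈V) λ ()) , λ _ → inj₁ refl
  go (v ∷ vs) {V} G (v# ∷ u) e = consDecomposition G (to e (here refl)) (proj₁ rest) , bags
    where
    e′ : ∀ {w} → w ∈ˡ vs ⇔ w ∈ V - v
    e′ = mk⇔ (λ w∈vs → x∈p∧x≢y⇒x∈p-y (to e (there w∈vs)) (λ { refl → All.lookup v# w∈vs refl }))
             (λ w∈ → remove w∈ (from e (x∈p-y⇒x∈p w∈)))
      where
      remove : ∀ {w} → w ∈ V - v → w ∈ˡ v ∷ vs → w ∈ˡ vs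
      remove w∈ (here refl)  = contradiction refl (x∈p-y⇒x≢y {p = V} w∈)
      remove w∈ (there w∈vs) = w∈vs
    rest = go vs (eliminate G v) u e′
    bags : ∀ t → _
    bags zero    = inj₂ (zero , refl)
    bags (suc t) with proj₂ rest t
    ... | inj₁ χ≡⊥       = inj₁ χ≡⊥
    ... | inj₂ (p , χ≡N) = inj₂ (suc p , χ≡N)

-- Threshold widths of CSP instances

mapEdges : ∀ {V : Subset n} {E E′ : Pred (Subset n) 0ℓ} → (∀ {e} → E′ e → E e) →
           TreeDecomposition V E → TreeDecomposition V E′
mapEdges E′⊆E D = record
  { nodeCount = nodeCount ; T = T ; T-tree = T-tree ; χ = χ ; χ⊆V = χ⊆V
  ; edge-in = edge-in ∘ E′⊆E ; subtree = subtree }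
  where open TreeDecomposition D

edge-clique : ∀ (G : Graph {n} ⊤) {e} → Graph.IsEdge G e → IsClique G e
edge-clique G (x , y , x~y , refl) = (λ _ → ∈⊤) , adj
  where
  open Graph G
  end : ∀ {z} → z ∈ ⁅ x ⁆ ∪ ⁅ y ⁆ → z ≡ x ⊎ z ≡ y
  end z∈ with x∈p∪q⁻ ⁅ x ⁆ ⁅ y ⁆ z∈
  ... | inj₁ z∈x = inj₁ (x∈⁅y⁆⇒x≡y x z∈x)
  ... | inj₂ z∈y = inj₂ (x∈⁅y⁆⇒x≡y y z∈y)
  adj : ∀ {a b} → a ∈ ⁅ x ⁆ ∪ ⁅ y ⁆ → b ∈ ⁅ x ⁆ ∪ ⁅ y ⁆ → a ≢ b → a ~ b
  adj a∈ b∈ a≢b with end a∈ | end b∈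
  ... | inj₁ refl | inj₁ refl = contradiction refl a≢b
  ... | inj₁ refl | inj₂ refl = x~y
  ... | inj₂ refl | inj₁ refl = ~-sym x~y
  ... | inj₂ refl | inj₂ refl = contradiction refl a≢b

-- Any two distinct variables in the scope of `q` are adjacent by virtue of `q` itself. Hence a
-- decomposition for cliques handles all hyperedges.
hyperedge-clique : ∀ (I : Instance n) {e} →
                   Hypergraph.IsHyperedge (constraintHypergraph I) e → IsClique (primalGraph I) e
hyperedge-clique I (q , refl) = (λ _ → ∈⊤) , λ x∈ y∈ x≢y → x≢y , q , x∈ , y∈

module _ (I : Instance n) (c d k : ℕ) where
  private
    Gᵈ = thresholdGraph I d
    Hᵈ = thresholdHypergraph I d
    G  = primalGraph I
    H  = constraintHypergraph I

  treewidth⇒ordering : ThresholdTreewidth≤ I d c k →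
    Σ (EliminationOrdering ⊤) λ σ →
      orderingWidth G σ ≤ k × (∀ i → AtMost c (MarkedGraph.HeavyIn Gᵈ (elimN[_] G σ i)))
  treewidth⇒ordering (D , load , width≤k)
    with treeDecomposition⇒ordering G edge-of D
    where
    edge-of : ∀ {x y} → Graph._~_ G x y → ∃ λ e → Graph.IsEdge G e × x ∈ e × y ∈ e
    edge-of {x} {y} x~y = _ , (x , y , x~y , refl) ,
      p⊆p∪q ⁅ y ⁆ (x∈⁅x⁆ x) , q⊆p∪q ⁅ x ⁆ ⁅ y ⁆ (x∈⁅x⁆ y)
  ... | σ , in-bag = σ ,
    maximum-≤ (λ i → ∣ elimN G σ i ∣) (λ i → let t , N⊆χ = in-bag i in
      -- The neighbourhood is strictly smaller than the closed one, which sits in a bag of at most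
      -- `suc k` vertices.
      s≤s⁻¹ (ℕ.≤-trans (∣N∣<∣N[]∣ (stage G σ (toℕ i)) _)
        (ℕ.≤-trans (p⊆q⇒∣p∣≤∣q∣ N⊆χ)
          (ℕ.≤-trans (≤-maximum (λ t → ∣ χ t ∣) t) (i-1≤k⇒i≤1+k width≤k))))) ,
    λ i → let t , N⊆χ = in-bag i in
      AtMost-mono (λ (v∈ , heavy) → N⊆χ v∈ , heavy) (load t)
    where open TreeDecomposition D

  ordering⇒treewidth :
    (Σ (EliminationOrdering ⊤) λ σ →
      orderingWidth G σ ≤ k × (∀ i → AtMost c (MarkedGraph.HeavyIn Gᵈ (elimN[_] G σ i)))) →
    ThresholdTreewidth≤ I d c k
  ordering⇒treewidth (σ , width≤k , load) =
    mapEdges (edge-clique G) D , heavy≤c , i≤1+k⇒i-1≤k (maximum-≤ (λ t → ∣ χ t ∣) size)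
    where
    result = ordering⇒cliqueDecomposition G σ
    D      = proj₁ result
    bag    = proj₂ result
    open TreeDecomposition D
    heavy≤c : ∀ t → AtMost c (MarkedGraph.HeavyIn Gᵈ (χ t))
    heavy≤c t with bag t
    ... | inj₁ χ≡⊥ rewrite χ≡⊥ = [] , z≤n , λ (v∈⊥ , _) → contradiction v∈⊥ ∉⊥
    ... | inj₂ (p , χ≡N) rewrite χ≡N = load p
    size : ∀ t → ∣ χ t ∣ ≤ suc k
    size t with bag t
    ... | inj₁ χ≡⊥ rewrite χ≡⊥ | ∣⊥∣≡0 n = z≤n
    ... | inj₂ (p , χ≡N) rewrite χ≡N =
      ℕ.≤-trans (∣N[]∣≤1+∣N∣ (stage G σ (toℕ p)) _)
        (s≤s (ℕ.≤-trans (≤-maximum (λ i → ∣ elimN G σ i ∣) p) width≤k))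

  CoverWithin : Subset n → Set
  CoverWithin S = ∃ λ F →
    MarkedHypergraph.IsEdgeCover Hᵈ S F × ∣ F ∣ ≤ k × AtMost c (MarkedHypergraph.HeavyIn Hᵈ F)

  hypertreeWidth⇒ordering : GeneralizedThresholdHypertreeWidth≤ I d c k →
    Σ (EliminationOrdering ⊤) λ σ →
      coverWidth G σ H ≤ k × (∀ i → CoverWithin (elimN[_] G σ i))
  hypertreeWidth⇒ordering (D , load , width≤k)
    with treeDecomposition⇒ordering G (λ (_ , q , x∈ , y∈) → _ , (q , refl) , x∈ , y∈)
           (GeneralizedHypertreeDecomposition.treeDecomposition D)
  ... | σ , in-bag = σ ,
    maximum-≤ (λ i → Hypergraph.coverNumber H (elimN[_] G σ i))
      -- The cover chosen for the surrounding bag also bounds the minimum cover.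
      (λ i → let _ , covers , F≤k , _ = within i in ℕ.≤-trans (coverNumber-≤ H covers) F≤k) ,
    within
    where
    open GeneralizedHypertreeDecomposition D
    within : ∀ i → CoverWithin (elimN[_] G σ i)
    within i = let t , N⊆χ = in-bag i in
      cover t , (λ v v∈N → isCover t v (N⊆χ v∈N)) ,
      ℕ.≤-trans (≤-maximum (λ t → ∣ cover t ∣) t) width≤k , load t

  ordering⇒hypertreeWidth :
    (Σ (EliminationOrdering ⊤) λ σ →
      coverWidth G σ H ≤ k × (∀ i → CoverWithin (elimN[_] G σ i))) →
    GeneralizedThresholdHypertreeWidth≤ I d c k
  ordering⇒hypertreeWidth (σ , _ , within) = record
    { treeDecomposition = mapEdges (hyperedge-clique I) D
    ; cover             = λ t → proj₁ (covered t)
    ; isCover           = λ t → proj₁ (proj₂ (covered t))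
    } ,
    (λ t → proj₂ (proj₂ (proj₂ (covered t)))) ,
    maximum-≤ (λ t → ∣ proj₁ (covered t) ∣) (λ t → proj₁ (proj₂ (proj₂ (covered t))))
    where
    result = ordering⇒cliqueDecomposition G σ
    D      = proj₁ result
    bag    = proj₂ result
    open TreeDecomposition D
    covered : ∀ t → CoverWithin (χ t)
    covered t with bag t
    -- The empty bag receives the empty cover; every other bag takes the cover that the ordering
    -- provides for its closed neighbourhood.
    ... | inj₁ χ≡⊥ rewrite χ≡⊥ =
      ⊥ , (λ _ v∈⊥ → contradiction v∈⊥ ∉⊥) ,
      ℕ.≤-trans (ℕ.≤-reflexive (∣⊥∣≡0 (Instance.constraintCount I))) z≤n ,
      [] , z≤n , λ (e∈⊥ , _) → contradiction e∈⊥ ∉⊥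
    ... | inj₂ (p , χ≡N) rewrite χ≡N = within p

theorem6 : ∀ {n} (I : Instance n) (c d k : ℕ) →
    let Gᵈ = thresholdGraph I d
        Hᵈ = thresholdHypergraph I d
        G  = MarkedGraph.graph Gᵈ
    in
    (ThresholdTreewidth≤ I d c k ⇔
      Σ (EliminationOrdering ⊤) λ σ →
        orderingWidth G σ ≤ k ×
        (∀ i → AtMost c (MarkedGraph.HeavyIn Gᵈ (elimN[_] G σ i))))
    ×
    (GeneralizedThresholdHypertreeWidth≤ I d c k ⇔
      Σ (EliminationOrdering ⊤) λ σ →
        coverWidth (primalGraph I) σ (constraintHypergraph I) ≤ k ×
        (∀ i → ∃ λ F →
          MarkedHypergraph.IsEdgeCover Hᵈ (elimN[_] G σ i) F ×
          ∣ F ∣ ≤ k ×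
          AtMost c (MarkedHypergraph.HeavyIn Hᵈ F)))
theorem6 I c d k =
  mk⇔ (treewidth⇒ordering I c d k) (ordering⇒treewidth I c d k) ,
  mk⇔ (hypertreeWidth⇒ordering I c d k) (ordering⇒hypertreeWidth I c d k)
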